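{- Let $\mathbb{F}$ be a field of characteristic zero, let $X=\{x_1,\ldots,x_n\}$, and let $f\in\mathbb{F}\langle X,X^{ -1}\rangle$ be a nonzero expression of degree $d$. Then $f$ is not an identity for the matrix algebra $\mathbb{M}_{2d}(\mathbb{F})$. That is, there exist invertible matrices $a_1,\ldots,a_n\in\mathbb{M}_{2d}(\mathbb{F})$ such that $f(a_1,\ldots,a_n)\neq 0$.
   Context: $\mathbb{F}\langle X,X^{ -1}\rangle$ denotes the free group algebra over $\mathbb{F}$ on the free group generated by $x_1,\ldots,x_n$. Its elements are finite $\mathbb{F}$-linear combinations $f=\sum_w \alpha_w w$ of reduced words $w$, i.e. words over $\{x_1,\ldots,x_n,x_1^{ -1},\ldots,x_n^{ -1}\}$ containing no adjacent pair $x_ix_i^{ -1}$ or $x_i^{ -1}x_i$. The only relations are $x_ix_i^{ -1}=x_i^{ -1}x_i=1$. The degree of $f$ is the maximum length of a reduced word $w$ with $\alpha_w\neq0$. For an associative $\mathbb{F}$-algebra $A$ with identity, $f$ is an identity for $A$ if $f(a_1,\ldots,a_n)=0$ for all $a_1,\ldots,a_n\in A$ such that each $a_i^{ -1}$ exists. Here $f(a_1,\ldots,a_n)$ is obtained by substituting $a_i$ for $x_i$ and $a_i^{ -1}$ for $x_i^{ -1}$.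
   Formalization: The degree d is assumed to be at least 1; for d = 0 the claim fails, since a nonzero constant vanishes in the zero algebra of 0×0 matrices. -}

module Defs where

open import Level using (Level; _⊔_)
open import Algebra.Bundles using (CommutativeRing)
open import Data.Nat using (ℕ; zero; suc) renaming (_⊔_ to _⊔ℕ_)
open import Data.Fin using (Fin; zero; suc)
open import Data.Bool using (Bool; true; false; not)
open import Data.List using (List; []; _∷_; length; map; foldr)
open import Data.List.Relation.Unary.All using (All)
open import Data.List.Relation.Unary.AllPairs using (AllPairs)
open import Data.Product using (_×_; _,_; proj₁; proj₂; Σ; ∃)
open import Relation.Binary.PropositionalEquality using (_≡_)
open import Relation.Nullary using (¬_)

module _ {c ℓ : Level} (R : CommutativeRing c ℓ) where
  open CommutativeRing R using (Carrier; _≈_; _+_; _*_; 0#; 1#)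

  natCast : ℕ → Carrier
  natCast zero    = 0#
  natCast (suc k) = 1# + natCast k

  IsFieldCR : Set (c ⊔ ℓ)
  IsFieldCR = (¬ (1# ≈ 0#)) × (∀ x → ¬ (x ≈ 0#) → Σ Carrier λ y → (x * y) ≈ 1#)

  CharZero : Set ℓ
  CharZero = ∀ k → ¬ (natCast (suc k) ≈ 0#)

-- Reduced words in the free group on x_1,...,x_n
-- a letter (i , true) is x_i, a letter (i , false) is x_i^{-1}

Letter : ℕ → Set
Letter n = Fin n × Bool

Word : ℕ → Set
Word n = List (Letter n)

Cancels : ∀ {n} → Letter n → Letter n → Set
Cancels (i , b) (j , b') = (i ≡ j) × (b' ≡ not b)

Reduced : ∀ {n} → Word n → Set
Reduced []            = Data.Unit.⊤ where import Data.Unit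
Reduced (a ∷ [])      = Data.Unit.⊤ where import Data.Unit
Reduced (a ∷ b ∷ w)   = (¬ Cancels a b) × Reduced (b ∷ w)

-- Elements of F<X,X^{-1}>, in canonical form: a finite list of
-- (coefficient , reduced word) with pairwise distinct words and nonzero
-- coefficients.  This representation is unique up to permutation;
-- the zero element is the empty list.

module _ {c ℓ : Level} (R : CommutativeRing c ℓ) where
  open CommutativeRing R using (Carrier; _≈_; _+_; _*_; 0#; 1#)

  Expr : ℕ → Set c
  Expr n = List (Carrier × Word n)

  Canonical : ∀ {n} → Expr n → Set (c ⊔ ℓ)
  Canonical f =
    All (λ t → Reduced (proj₂ t)) f ×
    All (λ t → ¬ (proj₁ t ≈ 0#)) f ×
    AllPairs (λ s t → ¬ (proj₂ s ≡ proj₂ t)) f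

  -- f ≠ 0 (for canonical f): at least one term
  NonzeroExpr : ∀ {n} → Expr n → Set
  NonzeroExpr [] = Data.Empty.⊥ where import Data.Empty
  NonzeroExpr (_ ∷ _) = Data.Unit.⊤ where import Data.Unit

  degree : ∀ {n} → Expr n → ℕ
  degree f = foldr (λ t d → length (proj₂ t) ⊔ℕ d) 0 f

  Matrix : ℕ → Set c
  Matrix m = Fin m → Fin m → Carrier

  sumFin : ∀ {m} → (Fin m → Carrier) → Carrier
  sumFin {zero}  g = 0#
  sumFin {suc m} g = g zero + sumFin (λ k → g (suc k))

  _⊗_ : ∀ {m} → Matrix m → Matrix m → Matrix m
  (A ⊗ B) i j = sumFin (λ k → A i k * B k j)

  _⊕_ : ∀ {m} → Matrix m → Matrix m → Matrix m
  (A ⊕ B) i j = A i j + B i j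

  scale : ∀ {m} → Carrier → Matrix m → Matrix m
  scale α A i j = α * A i j

  zeroM : ∀ {m} → Matrix m
  zeroM i j = 0#

  identM : ∀ {m} → Matrix m
  identM {suc m} zero    zero    = 1#
  identM {suc m} zero    (suc j) = 0#
  identM {suc m} (suc i) zero    = 0#
  identM {suc m} (suc i) (suc j) = identM {m} i j

  _≈M_ : ∀ {m} → Matrix m → Matrix m → Set ℓ
  A ≈M B = ∀ i j → A i j ≈ B i j

  IsInverse : ∀ {m} → Matrix m → Matrix m → Set ℓ
  IsInverse A B = ((A ⊗ B) ≈M identM) × ((B ⊗ A) ≈M identM)

  -- evaluation: substitute a i for x_i and b i (the inverse of a i) for x_i^{-1}
  evalLetter : ∀ {n m} → (Fin n → Matrix m) → (Fin n → Matrix m) → Letter n → Matrix m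
  evalLetter a b (i , true)  = a i
  evalLetter a b (i , false) = b i

  evalWord : ∀ {n m} → (Fin n → Matrix m) → (Fin n → Matrix m) → Word n → Matrix m
  evalWord a b []      = identM
  evalWord a b (l ∷ w) = evalLetter a b l ⊗ evalWord a b w

  evalExpr : ∀ {n m} → (Fin n → Matrix m) → (Fin n → Matrix m) → Expr n → Matrix m
  evalExpr a b []            = zeroM
  evalExpr a b ((α , w) ∷ f) = scale α (evalWord a b w) ⊕ evalExpr a b f

{-# OPTIONS --safe #-}
module Submission where

-- Let w = l₁ … l_d be a word of maximal length in f, and w̄ = l₁⁻¹ … l_d⁻¹.
-- Label the edges of a 2d-gon cyclically by l₁, …, l_d, l_d, …, l₁, so that the
-- two arcs from the origin to the opposite vertex both read w. A letter m acts
-- on the vertices: it traverses an edge labelled m forwards, or an edge labelled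
-- m⁻¹ backwards, and otherwise reflects the polygon in the axis through the
-- origin. Since w is reduced, m and m⁻¹ act inversely, giving monomial matrices.
-- Every step changes the distance to the origin by at most one, so among words
-- of length ≤ d only w and w̄ (along the two arcs) lead from the origin to the
-- opposite vertex. With weight t on one edge of the second arc, the corresponding
-- entry of f is A + t B, where A ≠ 0 and B are the coefficients of w and w̄, and t
-- is chosen to make this nonzero.

open import Defs
open import Level using (Level)
open import Algebra.Bundles using (CommutativeRing)
open import Data.Bool using (Bool; true; false; not)
import Data.Bool.Properties as Bool
open import Data.Empty using (⊥-elim)
open import Data.Nat using (ℕ; zero; suc; _*_; _≤_; _<_; s≤s)
import Data.Nat as ℕ
import Data.Nat.Properties as ℕ
open import Data.Fin using (Fin; zero; suc; toℕ; fromℕ; inject₁)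
import Data.Fin.Properties as Fin
open import Data.Fin.Relation.Unary.Top
  using (view; ‵fromℕ; ‵inject₁; view-fromℕ; view-inject₁)
open import Data.List using (List; []; _∷_; length; map; lookup; drop)
open import Data.List.Properties using (≡-dec; drop-all)
open import Data.List.Relation.Unary.All as All using (All; []; _∷_)
open import Data.List.Relation.Unary.Any using (here; there)
open import Data.List.Relation.Unary.AllPairs using (AllPairs; []; _∷_)
open import Data.List.Membership.Propositional using (_∈_)
open import Data.Product using (_×_; Σ; ∃; _,_; proj₁; proj₂)
import Data.Product.Properties as Product
open import Data.Product.Function.NonDependent.Propositional using (_×-↔_)
open import Data.Sum using (_⊎_; inj₁; inj₂)
open import Function.Bundles using (_↔_; module Inverse)
open import Function.Construct.Composition using (_↔-∘_)
open import Function.Construct.Identity using (↔-id)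
open import Relation.Binary.Definitions using (DecidableEquality)
open import Relation.Binary.PropositionalEquality as ≡ using (_≡_; _≢_; refl; cong; subst)
open import Relation.Nullary using (¬_; yes; no)

-- Letters, inversion and reduced words.

inv : ∀ {n} → Letter n → Letter n
inv (i , b) = i , not b

inv-involutive : ∀ {n} (m : Letter n) → inv (inv m) ≡ m
inv-involutive (i , b) = cong (i ,_) (Bool.not-involutive b)

inv-≢ : ∀ {n} (m : Letter n) → m ≢ inv m
inv-≢ (i , true)  ()
inv-≢ (i , false) ()

Cancels-inv : ∀ {n} {a b : Letter n} → b ≡ inv a → Cancels a b
Cancels-inv refl = refl , refl

_≟ˡ_ : ∀ {n} → DecidableEquality (Letter n)
_≟ˡ_ = Product.≡-dec Fin._≟_ Bool._≟_

_≟ʷ_ : ∀ {n} → DecidableEquality (Word n)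
_≟ʷ_ = ≡-dec _≟ˡ_

-- Translates the recursive `Reduced` into positions, the form in which the edge labels of the
-- polygon are compared.
Reduced-lookup : ∀ {n} (l : Letter n) (w : Word n) → Reduced (l ∷ w) →
  ∀ j → lookup w j ≢ inv (lookup (l ∷ w) (inject₁ j))
Reduced-lookup l (b ∷ w) (nc , _) zero    e = nc (Cancels-inv e)
Reduced-lookup l (b ∷ w) (_ , r)  (suc j) e = Reduced-lookup b w r j e

drop-lookup : ∀ {a} {A : Set a} (xs : List A) (k : Fin (length xs)) →
  drop (toℕ k) xs ≡ lookup xs k ∷ drop (suc (toℕ k)) xs
drop-lookup (x ∷ xs) zero    = refl
drop-lookup (x ∷ xs) (suc k) = drop-lookup xs k

-- The polygon, its rotation and its reflection.

-- The vertices of a 2d-gon, in cyclic order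
-- (true , 0), …, (true , d-1), (false , d-1), …, (false , 0).
Vertex : ℕ → Set
Vertex d = Bool × Fin d

vertexIndex : ∀ d → Fin (2 * d) ↔ Vertex d
vertexIndex d = (Fin.2↔Bool ×-↔ ↔-id (Fin d)) ↔-∘ Fin.*↔×

-- The cycle runs through the two rows in opposite senses, so `next` raises the index on the `true`
-- row and lowers it on the `false` row. At the end of a row a step changes the row and keeps the
-- index.
up down : ∀ {d} → Bool → Fin d → Vertex d
up s k with view k
... | ‵fromℕ     = not s , fromℕ _
... | ‵inject₁ j = s , suc j
down s zero    = not s , zero
down s (suc j) = s , inject₁ j

up-fromℕ : ∀ s d → up s (fromℕ d) ≡ (not s , fromℕ d)
up-fromℕ s d rewrite view-fromℕ d = refl

up-inject₁ : ∀ {d} s (j : Fin d) → up s (inject₁ j) ≡ (s , suc j)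
up-inject₁ s j rewrite view-inject₁ j = refl

-- `flip` is the reflection in an axis through the midpoints of two edges; composing it with `next`
-- moves the axis to the one through the origin and the opposite vertex.
next prev flip reflect : ∀ {d} → Vertex d → Vertex d
next (true  , k) = up true k
next (false , k) = down false k
prev (true  , k) = down true k
prev (false , k) = up false k
flip (s , k)     = not s , k
reflect v        = next (flip v)

next-prev : ∀ {d} (v : Vertex d) → next (prev v) ≡ v
next-prev (true , zero)  = refl
next-prev (true , suc j) = up-inject₁ true j
next-prev (false , k) with view k
... | ‵fromℕ     = up-fromℕ true _
... | ‵inject₁ j = refl

prev-next : ∀ {d} (v : Vertex d) → prev (next v) ≡ v
prev-next (false , zero)  = refl
prev-next (false , suc j) = up-inject₁ false j
prev-next (true , k) with view k
... | ‵fromℕ     = up-fromℕ false _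
... | ‵inject₁ j = refl

-- Exchanging the rows reverses the orientation of the cycle; with `flip-flip` this makes `reflect`
-- an involution.
flip-next : ∀ {d} (v : Vertex d) → flip (next v) ≡ prev (flip v)
flip-next (false , zero)  = refl
flip-next (false , suc j) = refl
flip-next (true , k) with view k
... | ‵fromℕ     = refl
... | ‵inject₁ j = refl

flip-flip : ∀ {d} (v : Vertex d) → flip (flip v) ≡ v
flip-flip (s , k) = cong (_, k) (Bool.not-involutive s)

reflect-reflect : ∀ {d} (v : Vertex d) → reflect (reflect v) ≡ v
reflect-reflect v = ≡.trans (cong next (≡.trans (flip-next (flip v)) (cong prev (flip-flip v)))) (next-prev v)

-- The distance of a vertex from the origin (true , 0) along the polygon.
level : ∀ {d} → Vertex d → ℕ
level (true  , k) = toℕ k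
level (false , k) = suc (toℕ k)

level-next-true : ∀ {d} (k : Fin d) → level (next (true , k)) ≡ suc (toℕ k)
level-next-true k with view k
... | ‵fromℕ     = refl
... | ‵inject₁ j = cong suc (≡.sym (Fin.toℕ-inject₁ j))

level-prev-true : ∀ {d} (j : Fin d) → level (prev (true , suc j)) ≡ toℕ j
level-prev-true j = Fin.toℕ-inject₁ j

level-next-false : ∀ {d} (k : Fin d) → level (next (false , k)) ≡ toℕ k
level-next-false zero    = refl
level-next-false (suc j) = cong suc (Fin.toℕ-inject₁ j)

level-reflect : ∀ {d} (v : Vertex d) → level (reflect v) ≡ level v
level-reflect (true  , k) = level-next-false k
level-reflect (false , k) = level-next-true k

level-next : ∀ {d} (v : Vertex d) → level (next v) ≤ suc (level v)
level-next (true  , k) = ℕ.≤-reflexive (level-next-true k)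
level-next (false , k) = ℕ.≤-trans (ℕ.≤-reflexive (level-next-false k)) (ℕ.m≤n+m (toℕ k) 2)

level-prev : ∀ {d} (v : Vertex d) → level (prev v) ≤ suc (level v)
level-prev (true , zero)  = ℕ.≤-refl
level-prev (true , suc j) = ℕ.≤-trans (ℕ.≤-reflexive (level-prev-true j)) (ℕ.m≤n+m (toℕ j) 2)
level-prev (false , k) with view k
... | ‵fromℕ     = ℕ.m≤n+m _ 2
... | ‵inject₁ j = ℕ.≤-reflexive (cong (λ i → suc (suc i)) (≡.sym (Fin.toℕ-inject₁ j)))

-- Edge labels and the moves of a letter.

module Polygon {n : ℕ} (l : Letter n) (w′ : Word n) (red : Reduced (l ∷ w′)) where

  w : Word n
  w = l ∷ w′

  d : ℕ
  d = length w

  -- The label of the edge from v to next v: around the polygon one reads w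
  -- and then w backwards.
  label : Vertex d → Letter n
  label (_ , k) = lookup w k

  -- Inside an arc this is reducedness of `w`. At the origin and at the opposite vertex both edges
  -- carry the same letter, which is not its own inverse.
  label-reduced : ∀ v → label v ≢ inv (label (prev v))
  label-reduced (true , zero)  = inv-≢ l
  label-reduced (true , suc j) = Reduced-lookup l w′ red j
  label-reduced (false , k) with view k
  ... | ‵fromℕ     = inv-≢ _
  ... | ‵inject₁ j = λ e → Reduced-lookup l w′ red j
          (≡.trans (≡.sym (inv-involutive _)) (cong inv (≡.sym e)))

  -- By `label-reduced`, `forward` and `backward` exclude each other, so the order of the tests in
  -- `move` does not affect the outcome. `mirror` completes the partial injection to a permutation
  -- without changing the level.
  data Move (m : Letter n) (v : Vertex d) : Set where
    forward  : label v ≡ m → Move m v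
    backward : label (prev v) ≡ inv m → Move m v
    mirror   : label v ≢ m → label (prev v) ≢ inv m → Move m v

  move : ∀ m v → Move m v
  move m v with label v ≟ˡ m | label (prev v) ≟ˡ inv m
  ... | yes p | _     = forward p
  ... | no p  | yes q = backward q
  ... | no p  | no q  = mirror p q

  target : ∀ {m v} → Move m v → Vertex d
  target {v = v} (forward _)  = next v
  target {v = v} (backward _) = prev v
  target {v = v} (mirror _ _) = reflect v

  level-target : ∀ {m v} (p : Move m v) → level (target p) ≤ suc (level v)
  level-target {v = v} (forward _)  = level-next v
  level-target {v = v} (backward _) = level-prev v
  level-target {v = v} (mirror _ _) = ℕ.≤-trans (ℕ.≤-reflexive (level-reflect v)) (ℕ.n≤1+n _)

  origin opposite : Vertex d
  origin   = true , zero
  opposite = false , fromℕ (length w′)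

  level-opposite : level opposite ≡ d
  level-opposite = cong suc (Fin.toℕ-fromℕ (length w′))

module Field {c ℓ : Level} (F : CommutativeRing c ℓ) where

  open CommutativeRing F hiding (zero) renaming (_*_ to _·_; refl to ≈-refl; sym to ≈-sym; trans to ≈-trans; reflexive to ≈-reflexive)
  open import Relation.Binary.Reasoning.Setoid setoid
  open import Algebra.Properties.CommutativeSemigroup +-commutativeSemigroup using (interchange)
  open import Algebra.Properties.CommutativeSemigroup *-commutativeSemigroup
    using (x∙yz≈y∙xz) renaming (interchange to ·-interchange)

  -- The identity matrix and sums against its rows.

  identM-diag : ∀ {m} (i : Fin m) → identM F i i ≈ 1#
  identM-diag zero    = ≈-refl
  identM-diag (suc i) = identM-diag i

  identM-off : ∀ {m} {i j : Fin m} → i ≢ j → identM F i j ≈ 0#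
  identM-off {i = zero}  {zero}  p = ⊥-elim (p refl)
  identM-off {i = zero}  {suc j} p = ≈-refl
  identM-off {i = suc i} {zero}  p = ≈-refl
  identM-off {i = suc i} {suc j} p = identM-off (λ e → p (cong suc e))

  sumFin-zero : ∀ {m} (g : Fin m → Carrier) → (∀ k → g k ≈ 0#) → sumFin F g ≈ 0#
  sumFin-zero {zero}  g h = ≈-refl
  sumFin-zero {suc m} g h = ≈-trans (+-cong (h zero) (sumFin-zero _ (λ k → h (suc k)))) (+-identityˡ 0#)

  -- A row of a monomial matrix is a multiple of a row of the identity, so multiplying by it selects
  -- and rescales one row of the other factor.
  sumFin-identM : ∀ {m} (x : Carrier) (p : Fin m) (g : Fin m → Carrier) →
    sumFin F (λ k → (x · identM F p k) · g k) ≈ x · g p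
  sumFin-identM x zero g = begin
    (x · 1#) · g zero + sumFin F (λ k → (x · 0#) · g (suc k))
      ≈⟨ +-cong (*-congʳ (*-identityʳ x)) (sumFin-zero _ (λ k → ≈-trans (*-congʳ (zeroʳ x)) (zeroˡ (g (suc k))))) ⟩
    x · g zero + 0#
      ≈⟨ +-identityʳ _ ⟩
    x · g zero ∎
  sumFin-identM x (suc p) g = begin
    (x · 0#) · g zero + sumFin F (λ k → (x · identM F p k) · g (suc k))
      ≈⟨ +-cong (≈-trans (*-congʳ (zeroʳ x)) (zeroˡ _)) (sumFin-identM x p (λ k → g (suc k))) ⟩
    0# + x · g (suc p)
      ≈⟨ +-identityˡ _ ⟩
    x · g (suc p) ∎

  -- Coefficients of words and the degree.

  -- The Kronecker delta on words, computed letter by letter so that it unfolds in step with a walk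
  -- on the polygon.
  indicator : ∀ {n} → Word n → Word n → Carrier
  indicator []      []      = 1#
  indicator []      (_ ∷ _) = 0#
  indicator (_ ∷ _) []      = 0#
  indicator (a ∷ u) (b ∷ v) with b ≟ˡ a
  ... | yes _ = indicator u v
  ... | no _  = 0#

  indicator-∷-≡ : ∀ {n} {a b : Letter n} u v → b ≡ a → indicator (a ∷ u) (b ∷ v) ≡ indicator u v
  indicator-∷-≡ {a = a} {b} u v e with b ≟ˡ a
  ... | yes _ = refl
  ... | no ne = ⊥-elim (ne e)

  indicator-∷-≢ : ∀ {n} {a b : Letter n} u v → b ≢ a → indicator (a ∷ u) (b ∷ v) ≡ 0#
  indicator-∷-≢ {a = a} {b} u v ne with b ≟ˡ a
  ... | yes e = ⊥-elim (ne e)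
  ... | no _  = refl

  indicator-refl : ∀ {n} (u : Word n) → indicator u u ≡ 1#
  indicator-refl []      = refl
  indicator-refl (a ∷ u) = ≡.trans (indicator-∷-≡ {a = a} u u refl) (indicator-refl u)

  indicator-≢ : ∀ {n} (u v : Word n) → u ≢ v → indicator u v ≡ 0#
  indicator-≢ []      []      ne = ⊥-elim (ne refl)
  indicator-≢ []      (_ ∷ _) ne = refl
  indicator-≢ (_ ∷ _) []      ne = refl
  indicator-≢ (a ∷ u) (b ∷ v) ne with b ≟ˡ a
  ... | yes refl = indicator-≢ u v (λ e → ne (cong (a ∷_) e))
  ... | no _     = refl

  -- A sum over all terms follows the recursion of `evalExpr`; when the words are distinct,
  -- `coefficient-∈` recovers the listed coefficient.
  coefficient : ∀ {n} → Word n → Expr F n → Carrier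
  coefficient u []            = 0#
  coefficient u ((α , v) ∷ f) = α · indicator v u + coefficient u f

  coefficient-∉ : ∀ {n} (u : Word n) (f : Expr F n) →
    All (λ s → u ≢ proj₂ s) f → coefficient u f ≈ 0#
  coefficient-∉ u []            []       = ≈-refl
  coefficient-∉ u ((α , v) ∷ f) (p ∷ ps) = begin
    α · indicator v u + coefficient u f
      ≈⟨ +-cong (*-congˡ (≈-reflexive (indicator-≢ v u (λ e → p (≡.sym e))))) (coefficient-∉ u f ps) ⟩
    α · 0# + 0#  ≈⟨ +-identityʳ _ ⟩
    α · 0#       ≈⟨ zeroʳ α ⟩
    0#           ∎

  coefficient-∈ : ∀ {n} {α} {u : Word n} {f : Expr F n} →
    AllPairs (λ s t → ¬ (proj₂ s ≡ proj₂ t)) f → (α , u) ∈ f → coefficient u f ≈ α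
  coefficient-∈ {α = α} {u} {_ ∷ f} (p ∷ _) (here refl) = begin
    α · indicator u u + coefficient u f
      ≈⟨ +-cong (*-congˡ (≈-reflexive (indicator-refl u))) (coefficient-∉ u f p) ⟩
    α · 1# + 0#  ≈⟨ +-identityʳ _ ⟩
    α · 1#       ≈⟨ *-identityʳ α ⟩
    α            ∎
  coefficient-∈ {α = α} {u} {(β , v) ∷ f} (p ∷ ps) (there m) = begin
    β · indicator v u + coefficient u f
      ≈⟨ +-cong (*-congˡ (≈-reflexive (indicator-≢ v u (All.lookup p m)))) (coefficient-∈ ps m) ⟩
    β · 0# + α  ≈⟨ +-congʳ (zeroʳ β) ⟩
    0# + α      ≈⟨ +-identityˡ α ⟩
    α           ∎

  ∈-or-∉ : ∀ {n} (u : Word n) (f : Expr F n) →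
    (∃ λ α → (α , u) ∈ f) ⊎ All (λ s → u ≢ proj₂ s) f
  ∈-or-∉ u [] = inj₂ []
  ∈-or-∉ u ((α , v) ∷ f) with u ≟ʷ v | ∈-or-∉ u f
  ... | yes refl | _              = inj₁ (α , here refl)
  ... | no _     | inj₁ (β , m)   = inj₁ (β , there m)
  ... | no ne    | inj₂ ps        = inj₂ (ne ∷ ps)

  length≤degree : ∀ {n} (f : Expr F n) → All (λ s → length (proj₂ s) ≤ degree F f) f
  length≤degree []            = []
  length≤degree ((α , v) ∷ f) =
    ℕ.m≤m⊔n _ _ ∷ All.map (λ p → ℕ.≤-trans p (ℕ.m≤n⊔m (length v) _)) (length≤degree f)

  degree-attained : ∀ {n} (f : Expr F n) → 1 ≤ degree F f →
    ∃ λ s → s ∈ f × length (proj₂ s) ≡ degree F f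
  degree-attained ((α , v) ∷ f) 1≤d with ℕ.⊔-sel (length v) (degree F f)
  ... | inj₁ e = (α , v) , here refl , ≡.sym e
  ... | inj₂ e with degree-attained f (subst (1 ≤_) e 1≤d)
  ...   | s , m , q = s , there m , ≡.trans q (≡.sym e)

  -- Invertible monomial matrices from the moves.

  module Representation {n : ℕ} (l : Letter n) (w′ : Word n) (red : Reduced (l ∷ w′))
    (t t⁻¹ : Carrier) (t·t⁻¹≈1 : t · t⁻¹ ≈ 1#) where

    open Polygon l w′ red

    encode : Vertex d → Fin (2 * d)
    encode = Inverse.from (vertexIndex d)

    decode : Fin (2 * d) → Vertex d
    decode = Inverse.to (vertexIndex d)

    decode-encode : ∀ v → decode (encode v) ≡ v
    decode-encode v = Inverse.inverseˡ (vertexIndex d) refl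

    encode-decode : ∀ i → encode (decode i) ≡ i
    encode-decode i = Inverse.inverseʳ (vertexIndex d) refl

    -- The special edge runs from `(false , zero)` to the origin. The second arc leaves the origin
    -- along it backwards and is to collect `t`, hence the forward weight `t⁻¹`.
    edgeWeight edgeWeight⁻¹ : Vertex d → Carrier
    edgeWeight (false , zero) = t⁻¹
    edgeWeight _              = 1#
    edgeWeight⁻¹ (false , zero) = t
    edgeWeight⁻¹ _              = 1#

    edgeWeight-inverse : ∀ v → edgeWeight⁻¹ v · edgeWeight v ≈ 1#
    edgeWeight-inverse (false , zero)  = t·t⁻¹≈1
    edgeWeight-inverse (false , suc _) = *-identityˡ 1#
    edgeWeight-inverse (true , _)      = *-identityˡ 1#

    weight : ∀ {m v} → Move m v → Carrier
    weight {v = v} (forward _)  = edgeWeight v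
    weight {v = v} (backward _) = edgeWeight⁻¹ (prev v)
    weight {v = v} (mirror _ _) = 1#

    -- After an edge is crossed, the same edge is available to the inverse letter, and
    -- `label-reduced` excludes continuing in the same direction. The reflection preserves labels
    -- and exchanges the incoming and outgoing edges, so a vertex mirrored by `m` goes to one
    -- mirrored by `inv m`.
    move-inverse : ∀ {m v} (p : Move m v) (q : Move (inv m) (target p)) →
      target q ≡ v × weight p · weight q ≈ 1#
    move-inverse {m} {v} (forward p) (forward q) =
      ⊥-elim (label-reduced (next v) (≡.trans q (cong inv (≡.trans (≡.sym p) (cong label (≡.sym (prev-next v)))))))
    move-inverse {m} {v} (forward p) (backward q) = prev-next v , (begin
      edgeWeight v · edgeWeight⁻¹ (prev (next v))
        ≈⟨ *-comm _ _ ⟩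
      edgeWeight⁻¹ (prev (next v)) · edgeWeight v
        ≈⟨ *-congʳ (≈-reflexive (cong edgeWeight⁻¹ (prev-next v))) ⟩
      edgeWeight⁻¹ v · edgeWeight v
        ≈⟨ edgeWeight-inverse v ⟩
      1# ∎)
    move-inverse {m} {v} (forward p) (mirror _ q) =
      ⊥-elim (q (≡.trans (cong label (prev-next v)) (≡.trans p (≡.sym (inv-involutive m)))))
    move-inverse {m} {v} (backward p) (forward q) = next-prev v , edgeWeight-inverse (prev v)
    move-inverse {m} {v} (backward p) (backward q) =
      ⊥-elim (label-reduced (prev v)
        (≡.trans p (cong inv (≡.sym (≡.trans q (inv-involutive m))))))
    move-inverse {m} {v} (backward p) (mirror q _) = ⊥-elim (q p)
    move-inverse {m} {v} (mirror p q) (forward r) =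
      ⊥-elim (q (≡.trans (cong label (≡.sym (≡.trans (flip-next (flip v)) (cong prev (flip-flip v))))) r))
    move-inverse {m} {v} (mirror p q) (backward r) =
      ⊥-elim (p (≡.trans (≡.sym (cong label (prev-next (flip v)))) (≡.trans r (inv-involutive m))))
    move-inverse {m} {v} (mirror p q) (mirror _ _) = reflect-reflect v , *-identityˡ 1#

    -- Rows stand for sources and columns for targets, so a product reads its word from left to
    -- right as a walk.
    letterMatrix : Letter n → Matrix F (2 * d)
    letterMatrix m i j = weight (move m (decode i)) · identM F (encode (target (move m (decode i)))) j

    letterMatrix-⊗ : ∀ m (B : Matrix F (2 * d)) v j →
      _⊗_ F (letterMatrix m) B (encode v) j ≈ weight (move m v) · B (encode (target (move m v))) j
    letterMatrix-⊗ m B v j = ≈-trans (sumFin-identM _ _ (λ k → B k j))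
      (≈-reflexive (cong (λ u → weight (move m u) · B (encode (target (move m u))) j) (decode-encode v)))

    letterMatrix-inverse : ∀ m → _≈M_ F (_⊗_ F (letterMatrix m) (letterMatrix (inv m))) (identM F)
    letterMatrix-inverse m i j = begin
      _⊗_ F (letterMatrix m) (letterMatrix (inv m)) i j
        ≈⟨ sumFin-identM (weight p) (encode (target p)) (λ k → letterMatrix (inv m) k j) ⟩
      weight p · letterMatrix (inv m) (encode (target p)) j
        ≈⟨ *-congˡ (≈-reflexive (cong (λ u → weight (move (inv m) u) · identM F (encode (target (move (inv m) u))) j)
             (decode-encode (target p)))) ⟩
      weight p · (weight q · identM F (encode (target q)) j)
        ≈⟨ *-assoc _ _ _ ⟨
      (weight p · weight q) · identM F (encode (target q)) j
        ≈⟨ *-cong (proj₂ (move-inverse p q))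
             (≈-reflexive (cong (λ k → identM F k j)
               (≡.trans (cong encode (proj₁ (move-inverse p q))) (encode-decode i)))) ⟩
      1# · identM F i j
        ≈⟨ *-identityˡ _ ⟩
      identM F i j ∎
      where
      p = move m (decode i)
      q = move (inv m) (target p)

    generator generator⁻¹ : Fin n → Matrix F (2 * d)
    generator   i = letterMatrix (i , true)
    generator⁻¹ i = letterMatrix (i , false)

    generator-inverse : ∀ i → IsInverse F (generator i) (generator⁻¹ i)
    -- Since `inv` exchanges the two letters, the same lemma gives both one-sided products.
    generator-inverse i = letterMatrix-inverse (i , true) , letterMatrix-inverse (i , false)

    -- Which short words lead to the opposite vertex.

    entry : Word n → Vertex d → Carrier
    entry u v = evalWord F generator generator⁻¹ u (encode v) (encode opposite)

    entry-∷ : ∀ m u v → entry (m ∷ u) v ≈ weight (move m v) · entry u (target (move m v))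
    entry-∷ (i , true)  u v = letterMatrix-⊗ (i , true)  (evalWord F generator generator⁻¹ u) v (encode opposite)
    entry-∷ (i , false) u v = letterMatrix-⊗ (i , false) (evalWord F generator generator⁻¹ u) v (encode opposite)

    entry-[]-opposite : entry [] opposite ≈ 1#
    entry-[]-opposite = identM-diag (encode opposite)

    entry-[] : ∀ v → v ≢ opposite → entry [] v ≈ 0#
    entry-[] v ne = identM-off {i = encode v} {encode opposite} (λ e → ne (≡.trans (≡.sym (decode-encode v))
      (≡.trans (cong decode e) (decode-encode opposite))))

    -- A letter raises the level by at most one, so the opposite vertex, at level `d`, is out of
    -- reach.
    entry-far : ∀ u v → length u ℕ.+ level v < d → entry u v ≈ 0#
    entry-far [] v lt = entry-[] v λ { refl → ℕ.<-irrefl level-opposite lt }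
    entry-far (m ∷ u) v lt = begin
      entry (m ∷ u) v                                    ≈⟨ entry-∷ m u v ⟩
      weight (move m v) · entry u (target (move m v))    ≈⟨ *-congˡ (entry-far u (target (move m v)) lt′) ⟩
      weight (move m v) · 0#                             ≈⟨ zeroʳ _ ⟩
      0#                                                 ∎
      where
      lt′ : length u ℕ.+ level (target (move m v)) < d
      lt′ = ℕ.≤-<-trans (ℕ.≤-trans (ℕ.+-monoʳ-≤ (length u) (level-target (move m v)))
              (ℕ.≤-reflexive (ℕ.+-suc (length u) (level v)))) lt

    drop-inject₁ : ∀ (j : Fin (length w′)) →
      drop (suc (toℕ (inject₁ j))) w ≡ lookup w (suc j) ∷ drop (suc (suc (toℕ j))) w
    drop-inject₁ j = ≡.trans (cong (λ i → drop i w′) (Fin.toℕ-inject₁ j)) (drop-lookup w′ j)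

    drop-fromℕ : drop (suc (toℕ (fromℕ (length w′)))) w ≡ []
    drop-fromℕ = drop-all (toℕ (fromℕ (length w′))) w′ (ℕ.≤-reflexive (≡.sym (Fin.toℕ-fromℕ (length w′))))

    -- At the opposite vertex the level is already `d`, and the length bound leaves no room for a
    -- further letter.
    beyond-opposite : ∀ (u : Word n) → ¬ (suc (length u) ℕ.+ suc (toℕ (fromℕ (length w′))) ≤ d)
    beyond-opposite u le = ℕ.<⇒≱ (s≤s (ℕ.m≤n+m _ (length u)))
      (subst (λ i → suc (length u ℕ.+ suc i) ≤ d) (Fin.toℕ-fromℕ (length w′)) le)

    -- The remaining letters at best just suffice to reach level `d`, so one step without a rise
    -- puts it out of reach.
    entry-descending : ∀ {m v} u (p : Move m v) → length (m ∷ u) ℕ.+ level v ≤ d →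
      level (target p) ≤ level v → weight p · entry u (target p) ≈ 0#
    entry-descending u p le lv =
      ≈-trans (*-congˡ (entry-far u (target p) (ℕ.≤-<-trans (ℕ.+-monoʳ-≤ (length u) lv) le))) (zeroʳ _)

    -- Only the unread part of `w` keeps rising along the first arc, whose edges all have weight 1.
    -- Writing the vertex as `next (true , k)` includes the opposite vertex, which lies on the other
    -- row, as the end of the induction.
    entry-rising : ∀ u k → length u ℕ.+ suc (toℕ k) ≤ d →
      entry u (next (true , k)) ≈ indicator u (drop (suc (toℕ k)) w)
    entry-rising u k le with view k
    entry-rising [] _ le | ‵fromℕ =
      ≈-trans entry-[]-opposite (≈-reflexive (cong (indicator []) (≡.sym drop-fromℕ)))
    entry-rising (m ∷ u) _ le | ‵fromℕ = ⊥-elim (beyond-opposite u le)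
    entry-rising [] _ le | ‵inject₁ j =
      ≈-trans (entry-[] (true , suc j) λ ()) (≈-reflexive (cong (indicator []) (≡.sym (drop-inject₁ j))))
    entry-rising (m ∷ u) _ le | ‵inject₁ j = begin
      entry (m ∷ u) v
        ≈⟨ entry-∷ m u v ⟩
      weight (move m v) · entry u (target (move m v))
        ≈⟨ go (move m v) ⟩
      indicator (m ∷ u) (lookup w (suc j) ∷ rest)
        ≡⟨ cong (indicator (m ∷ u)) (drop-inject₁ j) ⟨
      indicator (m ∷ u) (drop (suc (toℕ (inject₁ j))) w) ∎
      where
      v : Vertex d
      v = true , suc j

      rest : Word n
      rest = drop (suc (suc (toℕ j))) w

      le′ : length (m ∷ u) ℕ.+ level v ≤ d
      le′ = subst (λ i → length (m ∷ u) ℕ.+ suc i ≤ d) (Fin.toℕ-inject₁ j) le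

      go : (p : Move m v) → weight p · entry u (target p) ≈ indicator (m ∷ u) (lookup w (suc j) ∷ rest)
      go (forward p) = begin
        1# · entry u (next v)
          ≈⟨ *-identityˡ _ ⟩
        entry u (next v)
          ≈⟨ entry-rising u (suc j) (subst (_≤ d) (≡.sym (ℕ.+-suc (length u) _)) le′) ⟩
        indicator u rest
          ≡⟨ indicator-∷-≡ u rest p ⟨
        indicator (m ∷ u) (lookup w (suc j) ∷ rest) ∎
      -- The lost level kills the entry; the indicator vanishes as well, because the next letter of
      -- `w` is not inverse to the label of the edge just retraced.
      go (backward p) = ≈-trans
        (entry-descending {m} {v} u (backward p) le′ (ℕ.m≤n⇒m≤1+n (ℕ.≤-reflexive (level-prev-true j))))
        (≈-reflexive (≡.sym (indicator-∷-≢ u rest λ e → label-reduced v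
          (≡.trans e (≡.trans (≡.sym (inv-involutive m)) (cong inv (≡.sym p)))))))
      go (mirror p q) = ≈-trans
        (entry-descending {m} {v} u (mirror p q) le′ (ℕ.≤-reflexive (level-reflect v)))
        (≈-reflexive (≡.sym (indicator-∷-≢ u rest p)))

    -- The second arc is followed against its edges, so it reads inverse letters while the level
    -- still rises. The special edge lies behind, so no `t` appears.
    entry-falling : ∀ u k → length u ℕ.+ suc (toℕ k) ≤ d →
      entry u (false , k) ≈ indicator u (map inv (drop (suc (toℕ k)) w))
    entry-falling u k le with view k
    entry-falling [] _ le | ‵fromℕ =
      ≈-trans entry-[]-opposite (≈-reflexive (cong (λ x → indicator [] (map inv x)) (≡.sym drop-fromℕ)))
    entry-falling (m ∷ u) _ le | ‵fromℕ = ⊥-elim (beyond-opposite u le)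
    entry-falling [] _ le | ‵inject₁ j =
      ≈-trans (entry-[] (false , inject₁ j) (λ e → Fin.fromℕ≢inject₁ (≡.sym (cong proj₂ e))))
        (≈-reflexive (cong (λ x → indicator [] (map inv x)) (≡.sym (drop-inject₁ j))))
    entry-falling (m ∷ u) _ le | ‵inject₁ j = begin
      entry (m ∷ u) v
        ≈⟨ entry-∷ m u v ⟩
      weight (move m v) · entry u (target (move m v))
        ≈⟨ go (move m v) ⟩
      indicator (m ∷ u) (inv (lookup w (suc j)) ∷ rest)
        ≡⟨ cong (λ x → indicator (m ∷ u) (map inv x)) (drop-inject₁ j) ⟨
      indicator (m ∷ u) (map inv (drop (suc (toℕ (inject₁ j))) w)) ∎
      where
      v : Vertex d
      v = false , inject₁ j

      prev-v : prev v ≡ (false , suc j)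
      prev-v = up-inject₁ false j

      rest : Word n
      rest = map inv (drop (suc (suc (toℕ j))) w)

      le′ : length u ℕ.+ suc (suc (toℕ j)) ≤ d
      le′ = subst (_≤ d) (≡.sym (ℕ.+-suc (length u) _))
        (subst (λ i → length (m ∷ u) ℕ.+ suc i ≤ d) (Fin.toℕ-inject₁ j) le)

      go : (p : Move m v) → weight p · entry u (target p) ≈ indicator (m ∷ u) (inv (lookup w (suc j)) ∷ rest)
      go (forward p) = ≈-trans
        (entry-descending {m} {v} u (forward p) le
          (ℕ.m≤n⇒m≤1+n (ℕ.≤-reflexive (level-next-false (inject₁ j)))))
        (≈-reflexive (≡.sym (indicator-∷-≢ u rest λ e → Reduced-lookup l w′ red j
          (≡.trans (≡.sym (inv-involutive _)) (cong inv (≡.trans e (≡.sym p)))))))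
      go (backward p) = begin
        edgeWeight⁻¹ (prev v) · entry u (prev v)
          -- Only once `prev v` is known to have a successor index does its weight compute to 1.
          ≡⟨ cong (λ x → edgeWeight⁻¹ x · entry u x) prev-v ⟩
        1# · entry u (false , suc j)
          ≈⟨ *-identityˡ _ ⟩
        entry u (false , suc j)
          ≈⟨ entry-falling u (suc j) le′ ⟩
        indicator u rest
          ≡⟨ indicator-∷-≡ u rest (≡.trans (cong inv (≡.trans (≡.sym (cong label prev-v)) p)) (inv-involutive m)) ⟨
        indicator (m ∷ u) (inv (lookup w (suc j)) ∷ rest) ∎
      go (mirror p q) = ≈-trans
        (entry-descending {m} {v} u (mirror p q) le (ℕ.≤-reflexive (level-reflect v)))
        (≈-reflexive (≡.sym (indicator-∷-≢ u rest λ e →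
          q (≡.trans (cong label prev-v) (≡.trans (≡.sym (inv-involutive _)) (cong inv e))))))

    w̄ : Word n
    w̄ = map inv w

    -- The first letter chooses the arc: `l` starts the first, `inv l` starts the second through the
    -- special edge, and any other letter wastes a step. As these two letters differ, at most one
    -- summand survives.
    entry-origin : ∀ u → length u ≤ d → entry u origin ≈ indicator u w + t · indicator u w̄
    entry-origin [] le = ≈-trans (entry-[] origin λ ())
      (≈-sym (≈-trans (+-identityˡ _) (zeroʳ t)))
    entry-origin (m ∷ u) le = ≈-trans (entry-∷ m u origin) (go (move m origin))
      where
      le′ : length u ℕ.+ 1 ≤ d
      le′ = subst (_≤ d) (ℕ.+-comm 1 (length u)) le

      go : (p : Move m origin) →
        weight p · entry u (target p) ≈ indicator (m ∷ u) w + t · indicator (m ∷ u) w̄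
      go (forward p) = begin
        1# · entry u (next origin)     ≈⟨ *-identityˡ _ ⟩
        entry u (next origin)          ≈⟨ entry-rising u zero le′ ⟩
        indicator u w′                 ≈⟨ +-identityʳ _ ⟨
        indicator u w′ + 0#            ≈⟨ +-congˡ (zeroʳ t) ⟨
        indicator u w′ + t · 0#
          ≡⟨ ≡.cong₂ (λ x y → x + t · y) (indicator-∷-≡ u w′ p)
               (indicator-∷-≢ u (map inv w′) λ e → inv-≢ l (≡.trans p (≡.sym e))) ⟨
        indicator (m ∷ u) w + t · indicator (m ∷ u) w̄ ∎
      go (backward p) = begin
        t · entry u (false , zero)               ≈⟨ *-congˡ (entry-falling u zero le′) ⟩
        t · indicator u (map inv w′)             ≈⟨ +-identityˡ _ ⟨
        0# + t · indicator u (map inv w′)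
          ≡⟨ ≡.cong₂ (λ x y → x + t · y) (indicator-∷-≢ u w′ λ e → inv-≢ m (≡.trans (≡.sym e) p))
               (indicator-∷-≡ u (map inv w′) (≡.trans (cong inv p) (inv-involutive m))) ⟨
        indicator (m ∷ u) w + t · indicator (m ∷ u) w̄ ∎
      go (mirror p q) = begin
        1# · entry u (reflect origin)
          ≈⟨ entry-descending {m} {origin} u (mirror p q)
               (subst (_≤ d) (≡.sym (ℕ.+-identityʳ _)) le) (ℕ.≤-reflexive (level-reflect origin)) ⟩
        0#             ≈⟨ zeroʳ t ⟨
        t · 0#         ≈⟨ +-identityˡ _ ⟨
        0# + t · 0#
          ≡⟨ ≡.cong₂ (λ x y → x + t · y) (indicator-∷-≢ u w′ p)
               (indicator-∷-≢ u (map inv w′) λ e → q (≡.trans (≡.sym (inv-involutive l)) (cong inv e))) ⟨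
        indicator (m ∷ u) w + t · indicator (m ∷ u) w̄ ∎

    -- From words to expressions by linearity.

    evalExpr-entry : ∀ (f : Expr F n) → All (λ s → length (proj₂ s) ≤ d) f →
      evalExpr F generator generator⁻¹ f (encode origin) (encode opposite)
        ≈ coefficient w f + t · coefficient w̄ f
    evalExpr-entry [] [] = ≈-sym (≈-trans (+-identityˡ _) (zeroʳ t))
    evalExpr-entry ((α , u) ∷ f) (le ∷ les) = begin
      α · entry u origin + evalExpr F generator generator⁻¹ f (encode origin) (encode opposite)
        ≈⟨ +-cong (*-congˡ (entry-origin u le)) (evalExpr-entry f les) ⟩
      α · (x + t · y) + (a + t · b)
        ≈⟨ +-congʳ (≈-trans (distribˡ α x (t · y)) (+-congˡ (x∙yz≈y∙xz α t y))) ⟩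
      (α · x + t · (α · y)) + (a + t · b)
        ≈⟨ interchange _ _ _ _ ⟩
      (α · x + a) + (t · (α · y) + t · b)
        ≈⟨ +-congˡ (distribˡ t (α · y) b) ⟨
      (α · x + a) + t · (α · y + b) ∎
      where
      x y a b : Carrier
      x = indicator u w
      y = indicator u w̄
      a = coefficient w f
      b = coefficient w̄ f

  -- Choice of the weight and conclusion.

  module _ (isField : IsFieldCR F) where

    ·-nonzero : ∀ {x y} → ¬ x ≈ 0# → ¬ y ≈ 0# → ¬ x · y ≈ 0#
    ·-nonzero {x} {y} x≉0 y≉0 xy≈0 with proj₂ isField x x≉0
    ... | x⁻¹ , x·x⁻¹≈1 = y≉0 (begin
      y               ≈⟨ *-identityˡ y ⟨
      1# · y          ≈⟨ *-congʳ (≈-trans (*-comm x⁻¹ x) x·x⁻¹≈1) ⟨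
      (x⁻¹ · x) · y   ≈⟨ *-assoc x⁻¹ x y ⟩
      x⁻¹ · (x · y)   ≈⟨ *-congˡ xy≈0 ⟩
      x⁻¹ · 0#        ≈⟨ zeroʳ x⁻¹ ⟩
      0#              ∎)

    -- With t = A B⁻¹ the two contributions are equal, so they cannot cancel.
    separating-weight : CharZero F → ∀ {A B} → ¬ A ≈ 0# → B ≈ 0# ⊎ ¬ B ≈ 0# →
      ∃ λ t → ∃ λ t⁻¹ → t · t⁻¹ ≈ 1# × ¬ A + t · B ≈ 0#
    separating-weight _ {A} {B} A≉0 (inj₁ B≈0) = 1# , 1# , *-identityˡ 1# , λ e → A≉0 (begin
      A             ≈⟨ +-identityʳ A ⟨
      A + 0#        ≈⟨ +-congˡ (≈-trans (*-identityˡ B) B≈0) ⟨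
      A + 1# · B    ≈⟨ e ⟩
      0#            ∎)
    separating-weight char {A} {B} A≉0 (inj₂ B≉0)
      with proj₂ isField A A≉0 | proj₂ isField B B≉0
    -- `CharZero` counts from the successor, so `char 1` says that 2 is nonzero; the entry equals
    -- 2A.
    ... | A⁻¹ , A·A⁻¹≈1 | B⁻¹ , B·B⁻¹≈1 = A · B⁻¹ , B · A⁻¹ , unit , λ e → ·-nonzero (char 1) A≉0 (begin
      (1# + (1# + 0#)) · A   ≈⟨ *-congʳ (+-congˡ (+-identityʳ 1#)) ⟩
      (1# + 1#) · A          ≈⟨ distribʳ A 1# 1# ⟩
      1# · A + 1# · A        ≈⟨ +-cong (*-identityˡ A) (*-identityˡ A) ⟩
      A + A                  ≈⟨ +-congˡ (*-identityʳ A) ⟨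
      A + A · 1#             ≈⟨ +-congˡ (*-congˡ (≈-trans (*-comm B⁻¹ B) B·B⁻¹≈1)) ⟨
      A + A · (B⁻¹ · B)      ≈⟨ +-congˡ (*-assoc A B⁻¹ B) ⟨
      A + (A · B⁻¹) · B      ≈⟨ e ⟩
      0#                     ∎)
      where
      unit : (A · B⁻¹) · (B · A⁻¹) ≈ 1#
      unit = begin
        (A · B⁻¹) · (B · A⁻¹)  ≈⟨ *-congˡ (*-comm B A⁻¹) ⟩
        (A · B⁻¹) · (A⁻¹ · B)  ≈⟨ ·-interchange A B⁻¹ A⁻¹ B ⟩
        (A · A⁻¹) · (B⁻¹ · B)  ≈⟨ *-cong A·A⁻¹≈1 (≈-trans (*-comm B⁻¹ B) B·B⁻¹≈1) ⟩
        1# · 1#                ≈⟨ *-identityˡ 1# ⟩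
        1#                     ∎

    coefficient-≉0 : ∀ {n} {α} {u : Word n} {f : Expr F n} → Canonical F f →
      (α , u) ∈ f → ¬ coefficient u f ≈ 0#
    coefficient-≉0 (_ , nonzero , distinct) m e =
      All.lookup nonzero m (≈-trans (≈-sym (coefficient-∈ distinct m)) e)

    -- Equality in the field is not assumed decidable. What is decided is whether `u` occurs in `f`;
    -- canonical form makes the coefficient of an occurring word nonzero.
    coefficient-zero? : ∀ {n} (u : Word n) (f : Expr F n) → Canonical F f →
      coefficient u f ≈ 0# ⊎ ¬ coefficient u f ≈ 0#
    coefficient-zero? u f can with ∈-or-∉ u f
    ... | inj₁ (_ , m) = inj₂ (coefficient-≉0 can m)
    ... | inj₂ ps      = inj₁ (coefficient-∉ u f ps)

    -- Here `d` is a variable tied to `w` by an equation, so matching `refl` turns the matrix size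
    -- into twice the length of `l ∷ w′`; `1 ≤ d` excludes the empty word.
    nonvanishing : CharZero F → ∀ {n} (f : Expr F n) → Canonical F f →
      ∀ {α} (w : Word n) (d : ℕ) → (α , w) ∈ f → length w ≡ d → 1 ≤ d →
      All (λ s → length (proj₂ s) ≤ d) f →
      Σ (Fin n → Matrix F (2 * d)) λ a →
      Σ (Fin n → Matrix F (2 * d)) λ b →
      (∀ i → IsInverse F (a i) (b i)) × ¬ (_≈M_ F (evalExpr F a b f) (zeroM F))
    nonvanishing char f can (l ∷ w′) _ m refl _ les
      with separating-weight char (coefficient-≉0 can m) (coefficient-zero? (map inv (l ∷ w′)) f can)
    ... | t , t⁻¹ , t·t⁻¹≈1 , A+tB≉0 =
      generator , generator⁻¹ , generator-inverse ,
      λ e → A+tB≉0 (≈-trans (≈-sym (evalExpr-entry f les)) (e (encode origin) (encode opposite)))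
      where
      open Polygon l w′ (All.lookup (proj₁ can) m)
      open Representation l w′ (All.lookup (proj₁ can) m) t t⁻¹ t·t⁻¹≈1

theorem1 : {c ℓ : Level} (F : CommutativeRing c ℓ) →
    IsFieldCR F → CharZero F →
    (n : ℕ) (f : Expr F n) → Canonical F f → NonzeroExpr F f →
    1 ≤ degree F f →
    Σ (Fin n → Matrix F (2 * degree F f)) λ a →
    Σ (Fin n → Matrix F (2 * degree F f)) λ b →
    (∀ i → IsInverse F (a i) (b i)) ×
    ¬ (_≈M_ F (evalExpr F a b f) (zeroM F))
theorem1 F isField char n f can _ 1≤d with Field.degree-attained F f 1≤d
... | (α , w) , m , e =
  Field.nonvanishing F isField char f can w (degree F f) m e 1≤d (Field.length≤degree F f)
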